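{- Let $s$ be a Sturmian word. Then there exists a coloring $c:\mathcal F^+ s\to\{0,1,2\}$ of the non-empty factors of $s$ such that for every factorization $s=V_1V_2\cdots V_n\cdots$ of $s$ into non-empty factors $V_i$, there exist integers $i,j$ with $c(V_i)\neq c(V_j)$. (For instance, $c(V)=0$ if $V$ is not a prefix of $s$, $c(V)=1$ if $V$ is a prefix of $s$ with $r_s(V)=a$, and $c(V)=2$ if $V$ is a prefix of $s$ with $r_s(V)=b$.)
   Context: A Sturmian word is an infinite word $s\in\{a,b\}^{\omega}$ that is aperiodic (not ultimately periodic) and balanced: for all factors $u,v$ of $s$ with $|u|=|v|$ one has $||u|_x-|v|_x|\le 1$ for $x\in\{a,b\}$, where $|u|_x$ is the number of occurrences of $x$ in $u$. $\mathcal F^+ s$ is the set of non-empty factors of $s$. A non-empty factor $w$ of $s$ is rich in the letter $z\in\{a,b\}$ if there is a factor $v$ of $s$ with $|v|=|w|$ and $|w|_z>|v|_z$; every non-empty factor of a Sturmian word is rich in exactly one letter, and $r_s(w)\in\{a,b\}$ denotes that letter. -}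

module Defs where

open import Data.Fin.Base using (Fin)
open import Data.Fin.Patterns using (0F; 1F; 2F)
open import Data.List.Base using (List; []; length; filter; applyUpTo; concat)
open import Data.Nat.Base using (ℕ; _+_; _≤_; _<_; ∣_-_∣)
open import Data.Product.Base using (∃; ∃₂; _×_)
open import Data.Refinement.Base using (value; Refinement-syntax)
open import Relation.Binary.Definitions using (DecidableEquality)
open import Relation.Binary.PropositionalEquality.Core using (_≡_; _≢_; refl)
open import Relation.Nullary using (¬_; yes; no)

data Letter : Set where
  a b : Letter

_≟_ : DecidableEquality Letter
a ≟ a = yes refl
a ≟ b = no λ ()
b ≟ a = no λ ()
b ≟ b = yes refl

Word : Set
Word = List Letter

InfiniteWord : Set
InfiniteWord = ℕ → Letter

count : Letter → Word → ℕ
count x w = length (filter (x ≟_) w)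

IsFactor : InfiniteWord → Word → Set
IsFactor s w = ∃ λ i → w ≡ applyUpTo (λ k → s (i + k)) (length w)

IsPrefix : InfiniteWord → Word → Set
IsPrefix s w = w ≡ applyUpTo s (length w)

UltimatelyPeriodic : InfiniteWord → Set
UltimatelyPeriodic s = ∃₂ λ N p → 0 < p × (∀ n → N ≤ n → s (n + p) ≡ s n)

Balanced : InfiniteWord → Set
Balanced s = ∀ u v → IsFactor s u → IsFactor s v → length u ≡ length v →
             ∀ x → ∣ count x u - count x v ∣ ≤ 1

record Sturmian (s : InfiniteWord) : Set where
  field
    aperiodic : ¬ UltimatelyPeriodic s
    balanced  : Balanced s

-- The membership proof is irrelevant, so that a coloring of 𝓕⁺ s depends only
-- on the word and not on the position at which it occurs in s.
𝓕⁺ : InfiniteWord → Set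
𝓕⁺ s = [ w ∈ Word ∣ w ≢ [] × IsFactor s w ]

-- In a Sturmian word each non-empty factor w is rich in exactly one letter,
-- so RichIn s w z is the graph r_s(w) = z of the function r_s.
RichIn : InfiniteWord → Word → Letter → Set
RichIn s w z = ∃ λ v → IsFactor s v × length v ≡ length w × count z v < count z w

-- s = V 0 · V 1 · V 2 ⋯.  Since every V i is non-empty, the infinite product
-- is the unique infinite word having all the finite products as prefixes.
IsFactorization : (s : InfiniteWord) → (ℕ → 𝓕⁺ s) → Set
IsFactorization s V = ∀ n → IsPrefix s (concat (applyUpTo (λ i → value (V i)) n))

Coloring : InfiniteWord → Set
Coloring s = 𝓕⁺ s → Fin 3

NoMonochromaticFactorization : (s : InfiniteWord) → Coloring s → Set
NoMonochromaticFactorization s c =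
  ∀ V → IsFactorization s V → ∃₂ λ i j → c (V i) ≢ c (V j)

record IsPrefixRichnessColoring (s : InfiniteWord) (c : Coloring s) : Set where
  field
    nonPrefix     : ∀ V → ¬ IsPrefix s (value V) → c V ≡ 0F
    prefix-rich-a : ∀ V → IsPrefix s (value V) → RichIn s (value V) a → c V ≡ 1F
    prefix-rich-b : ∀ V → IsPrefix s (value V) → RichIn s (value V) b → c V ≡ 2F

{-# OPTIONS --safe #-}
-- A word rich in z has the maximal number of z's among the factors of its
-- length.  Suppose s = V₀V₁V₂⋯ with all Vᵢ prefixes of s that are rich in z.
-- For every t, some prefix of s is then a product of words rich in z of which t
-- have the same length m: if |Vᵢ| is bounded, some length m recurs; otherwise
-- take m = |V₀| and iterate U ↦ V₀⋯Vᵢ₋₁U with |Vᵢ| ≥ |U| and i ≥ 1, which maps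
-- prefixes of s to prefixes of s because Vᵢ begins with U.  On the other hand,
-- let h be the number of z's in a rich word of length m.  By aperiodicity, poor
-- factors of length m occur at two positions of s congruent modulo m, and then
-- balance yields a T such that every factor of length Tm has fewer than Th z's.
-- Exchanging blocks, a product of rich words with T of them of length m would
-- have more z's than any factor of its length.
module Submission where

open import Defs
open import Axiom.ExcludedMiddle using (ExcludedMiddle)
open import Data.Empty using (⊥; ⊥-elim-irr)
open import Data.Fin.Base using (Fin)
import Data.Fin.Properties as Fin
open import Data.Fin.Patterns using (0F; 1F; 2F)
open import Data.Irrelevant using ([_])
open import Data.List.Base using (List; []; _∷_; _++_; length; filter; take; concat; applyUpTo)
open import Data.List.Properties
  using (length-applyUpTo; length-++; filter-++; ++-cancelˡ; ++-identityʳ; concat-++;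
         applyUpTo-∷ʳ; ≡-dec)
open import Data.Nat.Base
  using (ℕ; zero; suc; _+_; _*_; _∸_; _⊔_; _≤_; _<_; z≤n; s≤s; z<s; NonZero; >-nonZero;
         _≤′_; ≤′-reflexive; ≤′-step)
open import Data.Nat.DivMod using (_/_; _%_; m≡m%n+[m/n]*n; m%n<n; /-monoˡ-≤)
open import Data.Nat.Properties renaming (_≟_ to _≟ℕ_)
open import Data.Nat.Tactic.RingSolver using (solve-∀)
open import Data.Product.Base using (∃; ∃₂; _×_; _,_; proj₁; proj₂)
open import Data.Refinement.Base using (value) renaming (_,_ to _,ᵣ_)
open import Data.Sum.Base using (_⊎_; inj₁; inj₂)
open import Function.Base using (_∘_)
open import Level using (0ℓ)
open import Relation.Binary.Definitions using (tri<; tri≈; tri>)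
open import Relation.Binary.PropositionalEquality
open import Relation.Nullary using (¬_; Dec; yes; no; contradiction)
open import Relation.Nullary.Decidable using (decidable-stable)

-- Infinite recurrence and the pigeonhole principle

Infinitely : (ℕ → Set) → Set
Infinitely P = ∀ N → ∃ λ i → N ≤ i × P i

infinitely? : ExcludedMiddle 0ℓ → (P : ℕ → Set) →
              Infinitely P ⊎ ∃ λ N → ∀ i → N ≤ i → ¬ P i
infinitely? em P with em {P = ∃ λ N → ∀ i → N ≤ i → ¬ P i}
... | yes fin = inj₂ fin
... | no ¬fin = inj₁ λ N → decidable-stable em
      λ ¬∃ → ¬fin (N , λ i N≤i Pi → ¬∃ (i , N≤i , Pi))

-- Induction on `L`: either the last class recurs forever, or beyond some `N` it no longer occurs
-- and the remaining classes cover infinitely many indices.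
infinite-pigeonhole : ExcludedMiddle 0ℓ → (Q : ℕ → ℕ → Set) → ∀ L →
  Infinitely (λ i → ∃ λ r → r < L × Q r i) → ∃ λ r → Infinitely (Q r)
infinite-pigeonhole em Q zero    inf with () ← proj₁ (proj₂ (proj₂ (proj₂ (inf 0))))
infinite-pigeonhole em Q (suc L) inf with infinitely? em (Q L)
... | inj₁ infL       = L , infL
... | inj₂ (N , ¬QL) = infinite-pigeonhole em Q L below
  where
  below : Infinitely (λ i → ∃ λ r → r < L × Q r i)
  below M with i , le , r , s≤s r≤L , q ← inf (M ⊔ N) =
    i , m⊔n≤o⇒m≤o M N le , r ,
    ≤∧≢⇒< r≤L (λ { refl → ¬QL i (m⊔n≤o⇒n≤o M N le) q }) , q

-- Finite words and letter counts

applyUpTo-cong : ∀ {A : Set} {f g : ℕ → A} → (∀ k → f k ≡ g k) →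
                 ∀ n → applyUpTo f n ≡ applyUpTo g n
applyUpTo-cong eq zero    = refl
applyUpTo-cong eq (suc n) = cong₂ _∷_ (eq 0) (applyUpTo-cong (eq ∘ suc) n)

applyUpTo-+ : ∀ {A : Set} (f : ℕ → A) m n →
              applyUpTo f (m + n) ≡ applyUpTo f m ++ applyUpTo (λ k → f (m + k)) n
applyUpTo-+ f zero    n = refl
applyUpTo-+ f (suc m) n = cong (f 0 ∷_) (applyUpTo-+ (f ∘ suc) m n)

concat-applyUpTo-suc : ∀ {A : Set} (f : ℕ → List A) n →
                       concat (applyUpTo f (suc n)) ≡ concat (applyUpTo f n) ++ f n
concat-applyUpTo-suc f n = begin
  concat (applyUpTo f (suc n))           ≡⟨ cong concat (applyUpTo-∷ʳ f n) ⟨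
  concat (applyUpTo f n ++ f n ∷ [])     ≡⟨ concat-++ (applyUpTo f n) (f n ∷ []) ⟨
  concat (applyUpTo f n) ++ (f n ++ [])  ≡⟨ cong (concat (applyUpTo f n) ++_) (++-identityʳ _) ⟩
  concat (applyUpTo f n) ++ f n          ∎
  where open ≡-Reasoning

count-++ : ∀ z u v → count z (u ++ v) ≡ count z u + count z v
count-++ z u v = trans (cong length (filter-++ (z ≟_) u v)) (length-++ (filter (z ≟_) u))

count-a+b : ∀ w → count a w + count b w ≡ length w
count-a+b []      = refl
count-a+b (a ∷ w) = cong suc (count-a+b w)
count-a+b (b ∷ w) = trans (+-suc (count a w) (count b w)) (cong suc (count-a+b w))

-- The alphabet is binary, so a letter is known once it is known whether it equals `z`.
count-singleton-injective : ∀ z x y → count z (x ∷ []) ≡ count z (y ∷ []) → x ≡ y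
count-singleton-injective z a a _ = refl
count-singleton-injective z b b _ = refl
count-singleton-injective a a b ()
count-singleton-injective b a b ()
count-singleton-injective a b a ()
count-singleton-injective b b a ()

-- Occurrences in windows of `s` and words with excess

window : InfiniteWord → ℕ → ℕ → Word
window s i n = applyUpTo (λ k → s (i + k)) n

occ : InfiniteWord → Letter → ℕ → ℕ → ℕ
occ s z i n = count z (window s i n)

Bound : InfiniteWord → Letter → ℕ → ℕ → Set
Bound s z n c = ∀ i → occ s z i n ≤ c

-- w has at least as many z's as t blocks of length m with h z's each, together
-- with any factor of s of the remaining length.
record Excess (s : InfiniteWord) (z : Letter) (m h t : ℕ) (w : Word) : Set where
  constructor excess
  field
    {rest cap} : ℕ
    bound      : Bound s z rest cap
    length-≡   : length w ≡ rest + t * m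
    count-≥    : cap + t * h ≤ count z w

module _ (s : InfiniteWord) where

  length-window : ∀ i n → length (window s i n) ≡ n
  length-window i n = length-applyUpTo _ n

  window-+ : ∀ i m n → window s i (m + n) ≡ window s i m ++ window s (i + m) n
  window-+ i m n = trans (applyUpTo-+ _ m n) (cong (window s i m ++_)
    (applyUpTo-cong (λ k → cong s (sym (+-assoc i m k))) n))

  window-factor : ∀ i n → IsFactor s (window s i n)
  window-factor i n = i , cong (window s i) (sym (length-window i n))

  window-shorten : ∀ {i j m n} → n ≤ m →
                   window s i m ≡ window s j m → window s i n ≡ window s j n
  window-shorten {i} {j} {m} {n} n≤m eq = begin
    window s i n           ≡⟨ take-window i ⟨
    take n (window s i m)  ≡⟨ cong (take n) eq ⟩
    take n (window s j m)  ≡⟨ take-window j ⟩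
    window s j n           ∎
    where
    open ≡-Reasoning
    take-applyUpTo : ∀ {f : ℕ → Letter} {n m} → n ≤ m →
                     take n (applyUpTo f m) ≡ applyUpTo f n
    take-applyUpTo z≤n     = refl
    take-applyUpTo (s≤s l) = cong (_ ∷_) (take-applyUpTo l)
    take-window : ∀ i → take n (window s i m) ≡ window s i n
    take-window i = take-applyUpTo n≤m

  module _ (z : Letter) where

    occ-+ : ∀ i m n → occ s z i (m + n) ≡ occ s z i m + occ s z (i + m) n
    occ-+ i m n = trans (cong (count z) (window-+ i m n)) (count-++ z (window s i m) _)

    Bound-+ : ∀ m n {c d} → Bound s z m c → Bound s z n d → Bound s z (m + n) (c + d)
    Bound-+ m n bm bn i = ≤-trans (≤-reflexive (occ-+ i m n)) (+-mono-≤ (bm i) (bn (i + m)))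

    Bound-* : ∀ m {c} → Bound s z m c → ∀ t → Bound s z (t * m) (t * c)
    Bound-* m bd zero    i = z≤n
    Bound-* m bd (suc t)   = Bound-+ m (t * m) bd (Bound-* m bd t)

    -- The window of length `n + 1` at `i` is counted twice, once with its first letter split off
    -- and once with its last; the remainders have equal counts.
    occ-shift-≡ : ∀ i n → occ s z i n ≡ occ s z (suc i) n → s (i + n) ≡ s i
    occ-shift-≡ i n eq = sym (subst₂ (λ x y → s x ≡ s y) (+-identityʳ i) (+-identityʳ (i + n))
      (count-singleton-injective z _ _ (+-cancelʳ-≡ (occ s z i n) _ _ (begin
        occ s z i 1 + occ s z i n              ≡⟨ cong (occ s z i 1 +_) eq ⟩
        occ s z i 1 + occ s z (suc i) n        ≡⟨ cong (λ k → occ s z i 1 + occ s z k n) (+-comm i 1) ⟨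
        occ s z i 1 + occ s z (i + 1) n        ≡⟨ occ-+ i 1 n ⟨
        occ s z i (1 + n)                      ≡⟨ cong (occ s z i) (+-comm 1 n) ⟩
        occ s z i (n + 1)                      ≡⟨ occ-+ i n 1 ⟩
        occ s z i n + occ s z (i + n) 1        ≡⟨ +-comm (occ s z i n) _ ⟩
        occ s z (i + n) 1 + occ s z i n        ∎))))
      where open ≡-Reasoning

    module _ {m h : ℕ} where

      Excess-++ : ∀ {t t′ u v} → Excess s z m h t u → Excess s z m h t′ v →
                  Excess s z m h (t + t′) (u ++ v)
      Excess-++ {t} {t′} {u} {v} (excess {n} {c} bd len le) (excess {n′} {c′} bd′ len′ le′) =
        excess (Bound-+ n n′ bd bd′)
          (trans (length-++ u) (trans (cong₂ _+_ len len′) (interchange n n′ t t′ m)))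
          (subst₂ _≤_ (interchange c c′ t t′ h) (sym (count-++ z u v)) (+-mono-≤ le le′))
        where
        interchange : ∀ x y t t′ k → (x + t * k) + (y + t′ * k) ≡ (x + y) + (t + t′) * k
        interchange = solve-∀

      Excess-[] : Excess s z m h 0 []
      Excess-[] = excess {rest = 0} {cap = 0} (λ _ → z≤n) refl z≤n

      Excess-bounded : ∀ {w} → Bound s z (length w) (count z w) → Excess s z m h 0 w
      Excess-bounded bd = excess bd (sym (+-identityʳ _)) (≤-reflexive (+-identityʳ _))

      Excess-block : ∀ {w} → length w ≡ m → h ≤ count z w → Excess s z m h 1 w
      Excess-block refl h≤ = excess {rest = 0} {cap = 0} (λ _ → z≤n) (sym (*-identityˡ _))
        (≤-trans (≤-reflexive (*-identityˡ h)) h≤)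

      -- `Excess` records only a length and a count, so the blocks may be taken to stand at the end:
      -- the first `rest` letters hold at most `cap` occurrences of `z`, and the last `t * m`
      -- letters fewer than `t * h`.
      ¬Excess-factor : ∀ {t w} → (∀ i → occ s z i (t * m) < t * h) →
                       IsFactor s w → ¬ Excess s z m h t w
      ¬Excess-factor {t} {w} lt (i , w≡) (excess {n} {c} bd len le) = <-irrefl refl (begin-strict
        c + t * h                                  ≤⟨ le ⟩
        count z w                                  ≡⟨ cong (count z) w≡ ⟩
        occ s z i (length w)                       ≡⟨ cong (occ s z i) len ⟩
        occ s z i (n + t * m)                      ≡⟨ occ-+ i n (t * m) ⟩
        occ s z i n + occ s z (i + n) (t * m)      <⟨ +-mono-≤-< (bd i) (lt (i + n)) ⟩
        c + t * h                                  ∎)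
        where open ≤-Reasoning

-- Balance, aperiodicity and richness

module _ (em : ExcludedMiddle 0ℓ) {s : InfiniteWord} (st : Sturmian s) where

  open Sturmian st

  balanced-≤ : ∀ z {u v} → IsFactor s u → IsFactor s v → length u ≡ length v →
               count z u ≤ suc (count z v)
  balanced-≤ z {u} {v} fu fv len = ≤-trans (m≤n+∣m-n∣ (count z u) (count z v))
    (≤-trans (+-monoʳ-≤ (count z v) (balanced u v fu fv len z))
      (≤-reflexive (+-comm (count z v) 1)))

  occ-balanced : ∀ z i j n → occ s z i n ≤ suc (occ s z j n)
  occ-balanced z i j n = balanced-≤ z (window-factor s i n) (window-factor s j n)
    (trans (length-window s i n) (sym (length-window s j n)))

  -- By balance a factor of this length exceeds the poorer witness `v` by at most one, and `w`
  -- already exceeds it by at least one.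
  rich⇒bound : ∀ {z w} → IsFactor s w → RichIn s w z → Bound s z (length w) (count z w)
  rich⇒bound {z} {w} fw (v , fv , len , lt) i =
    ≤-trans (balanced-≤ z {window s i (length w)} {v} (window-factor s i (length w)) fv
      (trans (length-window s i (length w)) (sym len))) lt

  -- If the count were eventually constant under shifts, `n` would be an eventual period of `s`.
  occ-changes : ∀ z {n} → 0 < n → Infinitely (λ i → occ s z i n ≢ occ s z (suc i) n)
  occ-changes z {n} 0<n with infinitely? em (λ i → occ s z i n ≢ occ s z (suc i) n)
  ... | inj₁ inf        = inf
  ... | inj₂ (N , const) = contradiction
    (N , n , 0<n , λ i N≤i → occ-shift-≡ s z i n (decidable-stable (_ ≟ℕ _) (const i N≤i)))
    aperiodic

  rich-nonempty : ∀ z w → RichIn s w z → 0 < length w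
  rich-nonempty z []      (_ , _ , _ , ())
  rich-nonempty z (_ ∷ _) _ = z<s

  -- Two consecutive windows differ in their number of `a`, so one of them differs from `w`. If it
  -- has fewer `a`, then `w` is rich in `a`; if it has more, it has fewer `b`.
  rich-a-or-b : ∀ {w} → 0 < length w → IsFactor s w → RichIn s w a ⊎ RichIn s w b
  rich-a-or-b {w} 0<w fw = compare-counts other
    where
    n = length w
    other : ∃ λ v → IsFactor s v × length v ≡ n × count a v ≢ count a w
    other with i , _ , changes ← occ-changes a 0<w 0 | occ s a i n ≟ℕ count a w
    ... | no  ≢w = window s i n , window-factor s i n , length-window s i n , ≢w
    ... | yes ≡w = window s (suc i) n , window-factor s (suc i) n , length-window s (suc i) n ,
                   λ ≡w′ → changes (trans ≡w (sym ≡w′))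
    compare-counts : (∃ λ v → IsFactor s v × length v ≡ n × count a v ≢ count a w) →
                     RichIn s w a ⊎ RichIn s w b
    compare-counts (v , fv , len , ≢w) with <-cmp (count a v) (count a w)
    ... | tri< lt _ _ = inj₁ (v , fv , len , lt)
    ... | tri≈ _ ≡w _ = contradiction ≡w ≢w
    ... | tri> _ _ gt = inj₂ (v , fv , len , +-cancelˡ-< (count a w) _ _ (begin-strict
        count a w + count b v   <⟨ +-monoˡ-< (count b v) gt ⟩
        count a v + count b v   ≡⟨ count-a+b v ⟩
        length v                ≡⟨ len ⟩
        length w                ≡⟨ count-a+b w ⟨
        count a w + count b w   ∎))
      where open ≤-Reasoning

  -- A word `v′` with fewer `b` than `w` has more `a` than `w`, hence at least two more than `v`,
  -- against balance.
  ¬rich-a-and-b : ∀ w → RichIn s w a → ¬ RichIn s w b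
  ¬rich-a-and-b w (v , fv , len , lt) (v′ , fv′ , len′ , lt′) = <-irrefl refl (begin-strict
    suc (count a v) + count b w  ≤⟨ +-monoˡ-≤ (count b w) lt ⟩
    count a w + count b w        ≡⟨ count-a+b w ⟩
    length w                     ≡⟨ len′ ⟨
    length v′                    ≡⟨ count-a+b v′ ⟨
    count a v′ + count b v′      <⟨ +-mono-≤-< (balanced-≤ a fv′ fv (trans len′ (sym len))) lt′ ⟩
    suc (count a v) + count b w  ∎)
    where open ≤-Reasoning

  -- Poor blocks and a strict bound on long factors

  module _ {z : Letter} {m h : ℕ} (0<m : 0 < m) (bound : Bound s z m h) where

    -- Wherever the count changes between neighbouring windows, the smaller of the two lies below
    -- `h`.
    poor-infinitely : Infinitely (λ i → occ s z i m < h)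
    poor-infinitely N
      with i , N≤i , changes ← occ-changes z 0<m N
      | <-cmp (occ s z i m) (occ s z (suc i) m)
    ... | tri< lt _ _ = i , N≤i , <-≤-trans lt (bound (suc i))
    ... | tri≈ _ eq _ = contradiction eq changes
    ... | tri> _ _ gt = suc i , m≤n⇒m≤1+n N≤i , <-≤-trans gt (bound i)

    poor-congruent : ∃₂ λ i e → occ s z i m < h × occ s z (i + m + e * m) m < h
    poor-congruent = from-residue (infinite-pigeonhole em
        (λ r i → occ s z i m < h × i % m ≡ r) m
        λ N → let i , N≤i , poor = poor-infinitely N in i , N≤i , i % m , m%n<n i m , poor , refl)
      where
      instance
        m≢0 : NonZero m
        m≢0 = >-nonZero 0<m
      from-residue : (∃ λ r → Infinitely (λ i → occ s z i m < h × i % m ≡ r)) → _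
      from-residue (r , inf)
        with i , _ , poor , i%m ← inf 0
        with j , i<j , poor′ , j%m ← inf (suc i) =
        i , e , poor , subst (λ k → occ s z k m < h) j≡ poor′
        where
        i≡ : i ≡ r + i / m * m
        i≡ = trans (m≡m%n+[m/n]*n i m) (cong (_+ _) i%m)
        j≡′ : j ≡ r + j / m * m
        j≡′ = trans (m≡m%n+[m/n]*n j m) (cong (_+ _) j%m)
        quotients : i / m < j / m
        quotients = ≤∧≢⇒< (/-monoˡ-≤ m (<⇒≤ i<j))
          λ eq → <⇒≢ i<j (trans i≡ (trans (cong (λ q → r + q * m) eq) (sym j≡′)))
        -- The number of whole blocks strictly between the two poor ones; the `suc` discounts the
        -- poor block at `i` itself.
        e = j / m ∸ suc (i / m)
        regroup : ∀ r q m e → r + (suc q + e) * m ≡ r + q * m + m + e * m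
        regroup = solve-∀
        j≡ : j ≡ i + m + e * m
        j≡ = begin
          j                                ≡⟨ j≡′ ⟩
          r + j / m * m                    ≡⟨ cong (λ q → r + q * m) (m+[n∸m]≡n quotients) ⟨
          r + (suc (i / m) + e) * m        ≡⟨ regroup r (i / m) m e ⟩
          r + i / m * m + m + e * m        ≡⟨ cong (λ k → k + m + e * m) i≡ ⟨
          i + m + e * m                    ∎
          where open ≡-Reasoning

    -- The window at `i` consists of `e` blocks between two poor ones, so it falls short of
    -- `(2 + e) * h` by at least two. Balance costs only one when passing to position `k`.
    poor-pair⇒strict-bound : ∀ i e → occ s z i m < h → occ s z (i + m + e * m) m < h →
                             ∀ k → occ s z k ((2 + e) * m) < (2 + e) * h
    poor-pair⇒strict-bound i e poor poor′ k =
      subst₂ (λ n c → occ s z k n < c) (reorder e m) (reorder e h) (begin-strict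
        occ s z k N          ≤⟨ occ-balanced z k i N ⟩
        suc (occ s z i N)    ≡⟨ cong suc splits ⟩
        suc (occ s z i m + (occ s z (i + m) (e * m) + occ s z (i + m + e * m) m))
                             ≤⟨ +-mono-≤ poor (+-monoˡ-≤ _ (Bound-* s z m bound e (i + m))) ⟩
        h + (e * h + occ s z (i + m + e * m) m)
                             <⟨ +-monoʳ-< h (+-monoʳ-< (e * h) poor′) ⟩
        h + (e * h + h)      ∎)
      where
      open ≤-Reasoning
      N = m + (e * m + m)
      reorder : ∀ e k → k + (e * k + k) ≡ (2 + e) * k
      reorder = solve-∀
      splits : occ s z i N ≡ occ s z i m + (occ s z (i + m) (e * m) + occ s z (i + m + e * m) m)
      splits = trans (occ-+ s z i m (e * m + m)) (cong (occ s z i m +_) (occ-+ s z (i + m) (e * m) m))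

    strict-bound : ∃ λ T → ∀ i → occ s z i (T * m) < T * h
    strict-bound = let i , e , poor , poor′ = poor-congruent in
      2 + e , poor-pair⇒strict-bound i e poor poor′

    ¬Excess-prefixes : ¬ (∀ t → ∃ λ j → Excess s z m h t (window s 0 j))
    ¬Excess-prefixes ex = let T , lt = strict-bound ; j , e = ex T in
      ¬Excess-factor s z {t = T} lt (window-factor s 0 j) e

  -- Factorizations into prefixes rich in the same letter

  module RichPrefixes {z : Letter} (v : ℕ → Word)
    (prefix : ∀ i → IsPrefix s (v i)) (rich : ∀ i → RichIn s (v i) z)
    (product : ∀ n → IsPrefix s (concat (applyUpTo v n))) where

    P : ℕ → Word
    P n = concat (applyUpTo v n)

    pos : ℕ → ℕ
    pos n = length (P n)

    heavy : ∀ i → Bound s z (length (v i)) (count z (v i))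
    heavy i = rich⇒bound {w = v i} (0 , prefix i) (rich i)

    heavy-≤ : ∀ i j → length (v i) ≡ length (v j) → count z (v i) ≤ count z (v j)
    heavy-≤ i j eq = subst (λ w → count z w ≤ count z (v j))
      (sym (trans (prefix i) (cong (window s 0) eq))) (heavy j 0)

    v-window : ∀ n → v n ≡ window s (pos n) (length (v n))
    v-window n = ++-cancelˡ (P n) _ _ (begin
      P n ++ v n                              ≡⟨ concat-applyUpTo-suc v n ⟨
      P (suc n)                               ≡⟨ product (suc n) ⟩
      window s 0 (pos (suc n))                ≡⟨ cong (window s 0) pos-suc ⟩
      window s 0 (pos n + l)                  ≡⟨ window-+ s 0 (pos n) l ⟩
      window s 0 (pos n) ++ window s (pos n) l ≡⟨ cong (_++ window s (pos n) l) (product n) ⟨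
      P n ++ window s (pos n) l               ∎)
      where
      open ≡-Reasoning
      l = length (v n)
      pos-suc : pos (suc n) ≡ pos n + l
      pos-suc = trans (cong length (concat-applyUpTo-suc v n)) (length-++ (P n))

    -- Both `v n` and `window s 0 j` are prefixes of `s`, so the shorter one begins the longer and
    -- reappears in `s` right after `P n`.
    product-prefix : ∀ n {j} → j ≤ length (v n) → P n ++ window s 0 j ≡ window s 0 (pos n + j)
    product-prefix n {j} j≤ = begin
      P n ++ window s 0 j                      ≡⟨ cong₂ _++_ (product n) same ⟩
      window s 0 (pos n) ++ window s (pos n) j ≡⟨ window-+ s 0 (pos n) j ⟨
      window s 0 (pos n + j)                   ∎
      where
      open ≡-Reasoning
      same : window s 0 j ≡ window s (pos n) j
      same = window-shorten s {0} {pos n} j≤ (trans (sym (prefix n)) (v-window n))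

    module _ {m h : ℕ} where

      Excess-snoc : ∀ {t t′} n → Excess s z m h t (P n) → Excess s z m h t′ (v n) →
                    Excess s z m h (t′ + t) (P (suc n))
      Excess-snoc {t} {t′} n ex ex′ = subst₂ (Excess s z m h) (+-comm t t′)
        (sym (concat-applyUpTo-suc v n)) (Excess-++ s z ex ex′)

      -- Each further factor is rich, so its length can be added to `rest` and its count to `cap`.
      Excess-extend : ∀ {t n n′} → n ≤′ n′ → Excess s z m h t (P n) → Excess s z m h t (P n′)
      Excess-extend (≤′-reflexive refl) ex = ex
      Excess-extend (≤′-step {n′} le)   ex =
        Excess-snoc n′ (Excess-extend le ex) (Excess-bounded s z (heavy n′))

    -- Every recurrence of the length contributes one more block, and the factors in between are
    -- absorbed into the rest.
    ¬recurring-length : ∀ i₀ → ¬ Infinitely (λ i → length (v i) ≡ length (v i₀))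
    ¬recurring-length i₀ inf =
      ¬Excess-prefixes {z} {m} {h} (rich-nonempty z (v i₀) (rich i₀)) (heavy i₀) λ t →
        let n , ex = grow t in pos n , subst (Excess s z m h t) (product n) ex
      where
      m = length (v i₀)
      h = count z (v i₀)
      grow : ∀ t → ∃ λ n → Excess s z m h t (P n)
      grow zero    = 0 , Excess-[] s z
      grow (suc t) =
        let n , ex       = grow t
            i , n≤i , eq = inf n
        in suc i , Excess-snoc i (Excess-extend (≤⇒≤′ n≤i) ex)
          (Excess-block s z eq (heavy-≤ i₀ i (sym eq)))

    ¬bounded-lengths : ∀ L → ¬ (∀ i → length (v i) < L)
    ¬bounded-lengths L lt =
      let m , inf     = infinite-pigeonhole em (λ r i → length (v i) ≡ r) L
                          (λ N → N , ≤-refl , _ , lt N , refl)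
          i₀ , _ , eq = inf 0
      in ¬recurring-length i₀ (subst (λ r → Infinitely (λ i → length (v i) ≡ r)) (sym eq) inf)

    ¬unbounded-lengths : ¬ (∀ L → ∃ λ i → L ≤ length (v i))
    ¬unbounded-lengths long =
      ¬Excess-prefixes {z} {m} {h} (rich-nonempty z (v 0) (rich 0)) (heavy 0) grow
      where
      m = length (v 0)
      h = count z (v 0)
      prepend : ∀ {t j} → Excess s z m h t (window s 0 j) → ∀ i → j + suc m ≤ length (v i) →
                ∃ λ k → Excess s z m h (suc t) (window s 0 k)
      -- The summand `suc m` rules out index zero, since `v 0` has length only `m`. Hence
      -- `P (suc i)` contains the block `v 0`.
      prepend {j = j} ex zero    le = contradiction (m+n≤o⇒n≤o j le) (<-irrefl refl)
      prepend {t} {j} ex (suc i) le = pos (suc i) + j ,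
        subst (Excess s z m h (suc t)) (product-prefix (suc i) (m+n≤o⇒m≤o j le))
          (Excess-++ s z (Excess-extend {n = 1} {n′ = suc i} (≤⇒≤′ (s≤s z≤n))
            (Excess-snoc 0 (Excess-[] s z) (Excess-block s z refl ≤-refl))) ex)
      grow : ∀ t → ∃ λ j → Excess s z m h t (window s 0 j)
      grow zero    = 0 , Excess-[] s z
      grow (suc t) =
        let j , ex = grow t
            i , le = long (j + suc m)
        in prepend ex i le

    no-rich-factorization : ⊥
    no-rich-factorization with em {P = ∃ λ L → ∀ i → length (v i) < L}
    ... | yes (L , lt) = ¬bounded-lengths L lt
    ... | no unbounded = ¬unbounded-lengths λ L → decidable-stable em
      λ short → unbounded (L , λ i → ≰⇒> λ le → short (i , le))

  -- The coloring by prefixes and richness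

  isPrefix? : ∀ w → Dec (IsPrefix s w)
  isPrefix? w = ≡-dec _≟_ w _

  richnessColor : ∀ {w} → Dec (IsPrefix s w) → Dec (RichIn s w a) → Fin 3
  richnessColor (no _)  _       = 0F
  richnessColor (yes _) (yes _) = 1F
  richnessColor (yes _) (no _)  = 2F

  coloring : Coloring s
  coloring V = richnessColor (isPrefix? (value V)) (em {P = RichIn s (value V) a})

  richnessColoring : IsPrefixRichnessColoring s coloring
  richnessColoring = record
    { nonPrefix     = nonPrefix
    ; prefix-rich-a = prefix-rich-a
    ; prefix-rich-b = prefix-rich-b
    }
    where
    nonPrefix : ∀ V → ¬ IsPrefix s (value V) → coloring V ≡ 0F
    nonPrefix V ¬p with isPrefix? (value V)
    ... | yes p = contradiction p ¬p
    ... | no _  = refl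
    prefix-rich-a : ∀ V → IsPrefix s (value V) → RichIn s (value V) a → coloring V ≡ 1F
    prefix-rich-a V p r with isPrefix? (value V) | em {P = RichIn s (value V) a}
    ... | no ¬p | _     = contradiction p ¬p
    ... | yes _ | yes _ = refl
    ... | yes _ | no ¬r = contradiction r ¬r
    prefix-rich-b : ∀ V → IsPrefix s (value V) → RichIn s (value V) b → coloring V ≡ 2F
    prefix-rich-b V p r with isPrefix? (value V) | em {P = RichIn s (value V) a}
    ... | no ¬p | _     = contradiction p ¬p
    ... | yes _ | yes r′ = contradiction r (¬rich-a-and-b (value V) r′)
    ... | yes _ | no _  = refl

  open IsPrefixRichnessColoring richnessColoring

  -- The membership proof is irrelevant and may be used only to refute the empty case, so the length
  -- is recovered by matching on the word.
  value-nonempty : (V : 𝓕⁺ s) → 0 < length (value V)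
  value-nonempty ([]    ,ᵣ [ p ]) = ⊥-elim-irr (proj₁ p refl)
  value-nonempty (_ ∷ _ ,ᵣ _)     = z<s

  ≢0F⇒prefix : ∀ V → coloring V ≢ 0F → IsPrefix s (value V)
  ≢0F⇒prefix V ≢0 = decidable-stable (isPrefix? (value V)) λ ¬p →
    ≢0 (nonPrefix V ¬p)

  rich-of-prefix : ∀ V → IsPrefix s (value V) → RichIn s (value V) a ⊎ RichIn s (value V) b
  rich-of-prefix V p = rich-a-or-b (value-nonempty V) (0 , p)

  -- Color `1F` forces a prefix, which is rich in some letter; richness in `b` would give color
  -- `2F`.
  1F⇒rich-a : ∀ V → coloring V ≡ 1F → RichIn s (value V) a
  1F⇒rich-a V eq with p ← ≢0F⇒prefix V (λ eq₀ → contradiction (trans (sym eq) eq₀) λ ())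
    with rich-of-prefix V p
  ... | inj₁ r = r
  ... | inj₂ r = contradiction (trans (sym eq) (prefix-rich-b V p r)) λ ()

  2F⇒rich-b : ∀ V → coloring V ≡ 2F → RichIn s (value V) b
  2F⇒rich-b V eq with p ← ≢0F⇒prefix V (λ eq₀ → contradiction (trans (sym eq) eq₀) λ ())
    with rich-of-prefix V p
  ... | inj₂ r = r
  ... | inj₁ r = contradiction (trans (sym eq) (prefix-rich-a V p r)) λ ()

  noMonochromaticFactorization : NoMonochromaticFactorization s coloring
  noMonochromaticFactorization V fact = decidable-stable em not-constant
    where
    not-constant : ¬ ¬ ∃₂ λ i j → coloring (V i) ≢ coloring (V j)
    not-constant const = by-color (coloring (V 0)) refl
      where
      color≡ : ∀ i → coloring (V i) ≡ coloring (V 0)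
      color≡ i = decidable-stable (_ Fin.≟ _) λ ≢ → const (i , 0 , ≢)
      V₀-prefix : IsPrefix s (value (V 0))
      V₀-prefix = subst (IsPrefix s) (++-identityʳ (value (V 0))) (fact 1)
      prefix-rich : ∀ {k z} → k ≢ 0F → (∀ W → coloring W ≡ k → RichIn s (value W) z) →
                    coloring (V 0) ≡ k → ⊥
      prefix-rich k≢0 rich eq = RichPrefixes.no-rich-factorization (value ∘ V)
        (λ i → ≢0F⇒prefix (V i) (λ eq₀ → k≢0 (trans (sym (trans (color≡ i) eq)) eq₀)))
        (λ i → rich (V i) (trans (color≡ i) eq)) fact
      by-color : ∀ k → coloring (V 0) ≡ k → ⊥
      by-color 1F = prefix-rich (λ ()) 1F⇒rich-a
      by-color 2F = prefix-rich (λ ()) 2F⇒rich-b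
      -- The first factor of any factorization is a prefix of `s`, so the common color cannot be
      -- `0F`.
      by-color 0F eq with rich-of-prefix (V 0) V₀-prefix
      ... | inj₁ r = contradiction (trans (sym eq) (prefix-rich-a (V 0) V₀-prefix r)) λ ()
      ... | inj₂ r = contradiction (trans (sym eq) (prefix-rich-b (V 0) V₀-prefix r)) λ ()

mainTheorem8 : ExcludedMiddle 0ℓ → (s : InfiniteWord) → Sturmian s →
    ∃ λ (c : Coloring s) → NoMonochromaticFactorization s c × IsPrefixRichnessColoring s c
mainTheorem8 em s st = coloring em st , noMonochromaticFactorization em st , richnessColoring em st
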